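{- The equation \[ (2^{k}-1)(3^{k}-1)=x^{n} \] has no solution in positive integers $k, x, n$ with $n>2$. -}

module Defs where

-- Suppose (2ᵏ - 1)(3ᵏ - 1) = xⁿ with n > 2. Every m ≤ n divides k, by strong
-- induction on m. Let pᵉ be a prime power dividing m. If p ≥ 5, the orders
-- u, v < p of 2 and 3 modulo p divide k, so p divides the product and therefore
-- pⁿ does. Lifting the exponent, if pᵉ did not divide k then p to the power
-- n - 2(e - 1) would divide (2ᵘ - 1)(3ᵛ - 1) < 6ᵖ⁻¹ ≤ pᵖ, contradicting
-- n ≥ pᵉ ≥ p + 2(e - 1). The primes 2 and 3 are handled by lifting from 3² - 1
-- and 2² - 1. In particular k = q n, and then xⁿ lies strictly between
-- (6^q - 1)ⁿ and (6^q)ⁿ.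

module Submission where

open import Defs
open import Data.Nat using (ℕ; _*_; _∸_; _^_; _<_; _≤_)
open import Relation.Binary.PropositionalEquality using (_≡_)
open import Relation.Nullary using (¬_)

open import Data.Nat using (zero; suc; _+_; _%_; _/_; z≤n; s≤s; s≤s⁻¹; NonZero;
  nonTrivial⇒n>1; >-nonZero)
open import Data.Nat.Properties
open import Data.Nat.Divisibility
open import Data.Nat.DivMod using (m≡m%n+[m/n]*n; m%n<n)
open import Data.Nat.Primality
open import Data.Nat.Primality.Factorisation using (factorise; module PrimeFactorisation)
open import Data.Nat.Induction using (<-rec)
open import Data.Nat.Tactic.RingSolver using (solve-∀)
open import Data.Fin as Fin using (Fin; toℕ; fromℕ<; punchOut)
import Data.Fin.Properties as Finₚ
open import Data.List.Base using ([]; _∷_)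
open import Data.Nat.ListAction using (product)
open import Data.List.Relation.Unary.All using (All; []; _∷_)
open import Data.Product using (∃-syntax; _×_; _,_)
open import Data.Sum using (inj₁; inj₂)
open import Function using (_∘_)
open import Relation.Binary.PropositionalEquality
  using (refl; sym; trans; cong; cong₂; subst; subst₂; _≢_)
open import Relation.Nullary using (yes; no; contradiction)
open import Relation.Nullary.Decidable using (from-yes)

-- Geometric sums and their residues modulo d and d².

-- The sum 1 + (1 + d) + ... + (1 + d)^(n - 1), that is ((1 + d)^n - 1) / d without subtraction or
-- division.
geom : ℕ → ℕ → ℕ
geom d zero    = 0
geom d (suc n) = 1 + (1 + d) * geom d n

pow-geom : ∀ d n → (1 + d) ^ n ≡ 1 + d * geom d n
pow-geom d zero    = cong suc (sym (*-zeroʳ d))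
pow-geom d (suc n) = trans (cong ((1 + d) *_) (pow-geom d n)) (step d (geom d n))
  where
  step : ∀ d g → (1 + d) * (1 + d * g) ≡ 1 + d * (1 + (1 + d) * g)
  step = solve-∀

pow∸1-geom : ∀ d n → (1 + d) ^ n ∸ 1 ≡ d * geom d n
pow∸1-geom d n = cong (_∸ 1) (pow-geom d n)

geom-mod-d : ∀ d n → ∃[ x ] geom d n ≡ n + d * x
geom-mod-d d zero    = 0 , sym (*-zeroʳ d)
geom-mod-d d (suc n) with x , eq ← geom-mod-d d n =
  n + x + d * x , trans (cong (λ g → 1 + (1 + d) * g) eq) (step d n x)
  where
  step : ∀ d n x → 1 + (1 + d) * (n + d * x) ≡ 1 + n + d * (n + x + d * x)
  step = solve-∀

-- Doubled so that the binomial coefficient n (n - 1) / 2 needs no division.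
geom-mod-d² : ∀ d n → ∃[ y ] 2 * geom d (1 + n) ≡ 2 * (1 + n) + (n * (1 + n) * d + d * d * y)
geom-mod-d² d zero    = 0 , base d
  where
  base : ∀ d → 2 * (1 + (1 + d) * 0) ≡ 2 * 1 + (0 + d * d * 0)
  base = solve-∀
geom-mod-d² d (suc n) with y , eq ← geom-mod-d² d n =
  n * (1 + n) + y + d * y ,
  trans (distrib d (geom d (1 + n))) (trans (cong (λ g → 2 + (1 + d) * g) eq) (step d n y))
  where
  distrib : ∀ d g → 2 * (1 + (1 + d) * g) ≡ 2 + (1 + d) * (2 * g)
  distrib = solve-∀
  step : ∀ d n y → 2 + (1 + d) * (2 * (1 + n) + (n * (1 + n) * d + d * d * y))
       ≡ 2 * (2 + n) + ((1 + n) * (2 + n) * d + d * d * (n * (1 + n) + y + d * y))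
  step = solve-∀

-- Divisibility of powers and by prime powers.

^-monoˡ-∣ : ∀ n {a b} → a ∣ b → a ^ n ∣ b ^ n
^-monoˡ-∣ zero    a∣b = ∣-refl
^-monoˡ-∣ (suc n) a∣b = *-pres-∣ a∣b (^-monoˡ-∣ n a∣b)

^-monoʳ-∣ : ∀ a {m n} → m ≤ n → a ^ m ∣ a ^ n
^-monoʳ-∣ a {m} {n} m≤n = subst (a ^ m ∣_)
  (trans (sym (^-distribˡ-+-* a m (n ∸ m))) (cong (a ^_) (m+[n∸m]≡n m≤n))) (m∣m*n _)

∣⇒^∸1∣^∸1 : ∀ a {u k} → 1 ≤ a → u ∣ k → a ^ u ∸ 1 ∣ a ^ k ∸ 1
∣⇒^∸1∣^∸1 (suc d) {u} 1≤a (divides q refl) = subst (suc d ^ u ∸ 1 ∣_) eq (m∣m*n _)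
  where
  c : ℕ
  c = suc d ^ u ∸ 1
  eq : c * geom c q ≡ suc d ^ (q * u) ∸ 1
  eq = trans (sym (pow∸1-geom c q)) (cong (_∸ 1)
    (trans (cong (_^ q) (m+[n∸m]≡n (m^n>0 (suc d) u)))
    (trans (^-*-assoc (suc d) u q) (cong (suc d ^_) (*-comm u q)))))

prime∣^⇒∣ : ∀ {p} → Prime p → ∀ a n → p ∣ a ^ n → p ∣ a
prime∣^⇒∣ pp a zero    p∣1 = ∣-trans p∣1 (1∣ a)
prime∣^⇒∣ pp a (suc n) p∣ with euclidsLemma a (a ^ n) pp p∣
... | inj₁ p∣a  = p∣a
... | inj₂ p∣aⁿ = prime∣^⇒∣ pp a n p∣aⁿ

-- Euclid's lemma gives one factor `p` to `u` or to `v`; cancel it and repeat.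
prime-pow-split : ∀ {p} → Prime p → ∀ a u v → p ^ a ∣ u * v →
                  ∃[ b ] ∃[ c ] b + c ≡ a × p ^ b ∣ u × p ^ c ∣ v
prime-pow-split pp zero u v _ = 0 , 0 , refl , 1∣ u , 1∣ v
prime-pow-split {p} pp (suc a) u v p∣ with euclidsLemma u v pp (m*n∣⇒m∣ p (p ^ a) p∣)
... | inj₁ (divides q refl)
  with b , c , eq , x , y ← prime-pow-split pp a q v (*-cancelˡ-∣ p {{prime⇒nonZero pp}}
         (subst (p * p ^ a ∣_) (trans (cong (_* v) (*-comm q p)) (*-assoc p q v)) p∣))
  = suc b , c , cong suc eq , subst (p * p ^ b ∣_) (*-comm p q) (*-monoʳ-∣ p x) , y
... | inj₂ (divides q refl)
  with b , c , eq , x , y ← prime-pow-split pp a u q (*-cancelˡ-∣ p {{prime⇒nonZero pp}}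
         (subst (p * p ^ a ∣_) (trans (sym (*-assoc u q p)) (*-comm (u * q) p)) p∣))
  = b , suc c , trans (+-suc b c) (cong suc eq) , x , subst (p * p ^ c ∣_) (*-comm p q) (*-monoʳ-∣ p y)

-- In a split `b + c` of `a`, at most `i` of the factors `p` can go to `v`.
prime-pow∣* : ∀ {p} → Prime p → ∀ i a u v → p ^ a ∣ u * v → ¬ p ^ suc i ∣ v → p ^ (a ∸ i) ∣ u
prime-pow∣* {p} pp i a u v p∣ ∤v with prime-pow-split pp a u v p∣
... | b , c , refl , x , y with c ≤? i
... | yes c≤i = ∣-trans (^-monoʳ-∣ p (m≤n+o⇒m∸n≤o (b + c) i
                  (≤-trans (≤-reflexive (+-comm b c)) (+-monoˡ-≤ b c≤i)))) x
... | no  c≰i = contradiction (∣-trans (^-monoʳ-∣ p (≰⇒> c≰i)) y) ∤v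

p^1∣⇒p∣ : ∀ p {v} → p ^ 1 ∣ v → p ∣ v
p^1∣⇒p∣ p {v} = subst (_∣ v) (*-identityʳ p)

p^2∣⇒p*p∣ : ∀ p {v} → p ^ 2 ∣ v → p * p ∣ v
p^2∣⇒p*p∣ p {v} = subst (λ q → p * q ∣ v) (*-identityʳ p)

-- Lifting the exponent.

-- (1 + D)ᵖ - 1 = D * geom D p, so this says that a p-th power contributes
-- just one factor p beyond those of D.
Liftable : ℕ → ℕ → Set
Liftable p d = ∀ {D} → d ∣ D → ¬ p * p ∣ geom D p

-- Modulo D², twice the sum is 2p + (p - 1)pD. As p divides D, both D² and (p - 1)pD vanish modulo
-- p², so p² would divide 2p.
liftable-odd : ∀ {p d} → Prime p → 2 < p → p ∣ d → Liftable p d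
liftable-odd {suc m} {d} pp 2<p p∣d {D} d∣D p²∣ with y , eq ← geom-mod-d² D m =
  <⇒≱ 2<p (∣⇒≤ p∣2)
  where
  p = suc m
  p∣D : p ∣ D
  p∣D = ∣-trans p∣d d∣D
  p²∣tail : p * p ∣ m * p * D + D * D * y
  p²∣tail = ∣m∣n⇒∣m+n (*-pres-∣ (n∣m*n m) p∣D) (∣m⇒∣m*n y (*-pres-∣ p∣D p∣D))
  p²∣2p : p * p ∣ 2 * p
  p²∣2p = ∣m+n∣m⇒∣n (subst (p * p ∣_) (trans eq (+-comm (2 * p) _)) (∣n⇒∣m*n 2 p²∣)) p²∣tail
  p∣2 : p ∣ 2
  p∣2 = *-cancelʳ-∣ p p²∣2p

-- Here the sum is D + 2. Evenness of D would not do: D = 2 gives 4.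
liftable-two : ∀ {d} → 4 ∣ d → Liftable 2 d
liftable-two {d} 4∣d {D} d∣D 4∣ = 4∤2 (∣m+n∣m⇒∣n (subst (4 ∣_) (eq D) 4∣) (∣-trans 4∣d d∣D))
  where
  eq : ∀ D → 1 + (1 + D) * (1 + (1 + D) * 0) ≡ D + 2
  eq = solve-∀
  4∤2 : ¬ 4 ∣ 2
  4∤2 h with s≤s (s≤s ()) ← ∣⇒≤ h

∤⇒∤geom : ∀ {p d m} → p ∣ d → ¬ p ∣ m → ¬ p ∣ geom d m
∤⇒∤geom {p} {d} {m} p∣d p∤m p∣g with x , eq ← geom-mod-d d m =
  p∤m (∣m+n∣m⇒∣n (subst (p ∣_) (trans eq (+-comm m _)) p∣g) (∣m⇒∣m*n x p∣d))

-- If p does not divide m, then `geom d m` is prime to p. If m = q p, then (1 + d)^m - 1 is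
-- `D * geom D p` with D = (1 + d)^q - 1; passing to D loses at most one factor p, and induction on
-- `j` applies to q.
lifting : ∀ {p} → Prime p → ∀ j d m a → p ∣ d → Liftable p d →
          ¬ p ^ suc j ∣ m → p ^ a ∣ d * geom d m → p ^ (a ∸ j) ∣ d
lifting {p} pp j d m a p∣d good ∤m p∣ with p ∣? m
... | no p∤m = ∣-trans (^-monoʳ-∣ p (m∸n≤m a j))
      (prime-pow∣* pp 0 a d (geom d m) p∣ (∤⇒∤geom p∣d p∤m ∘ p^1∣⇒p∣ p))
lifting {p} pp zero d m a p∣d good ∤m p∣ | yes p∣m =
  contradiction (subst (_∣ m) (sym (*-identityʳ p)) p∣m) ∤m
lifting {p} pp (suc j) d .(q * p) a p∣d good ∤m p∣ | yes (divides q refl) =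
  subst (λ e → p ^ e ∣ d) (∸-+-assoc a 1 j)
    (lifting pp j d q (a ∸ 1) p∣d good
      (λ h → ∤m (subst (p ^ (2 + j) ∣_) (*-comm p q) (*-monoʳ-∣ p h)))
      (prime-pow∣* pp 1 a D (geom D p) (subst (p ^ a ∣_) eq p∣) (good (m∣m*n _) ∘ p^2∣⇒p*p∣ p)))
  where
  D : ℕ
  D = d * geom d q
  eq : d * geom d (q * p) ≡ D * geom D p
  eq = trans (sym (pow∸1-geom d (q * p))) (trans (cong (_∸ 1)
    (trans (sym (^-*-assoc (1 + d) q p)) (cong (_^ p) (pow-geom d q)))) (pow∸1-geom D p))

lifting-pow : ∀ {p} → Prime p → ∀ j c u q {k} a → 1 ≤ c → k ≡ q * u → p ∣ c ^ u ∸ 1 →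
              Liftable p (c ^ u ∸ 1) → ¬ p ^ suc j ∣ q → p ^ a ∣ c ^ k ∸ 1 → p ^ (a ∸ j) ∣ c ^ u ∸ 1
lifting-pow {p} pp j c@(suc _) u q a 1≤c refl p∣ good ∤q p^a∣ =
  lifting pp j d q a p∣ good ∤q (subst (p ^ a ∣_) eq p^a∣)
  where
  d : ℕ
  d = c ^ u ∸ 1
  eq : c ^ (q * u) ∸ 1 ≡ d * geom d q
  eq = trans (cong (_∸ 1) (trans (cong (c ^_) (*-comm q u)) (trans (sym (^-*-assoc c u q))
    (cong (_^ q) (sym (m+[n∸m]≡n (m^n>0 c u))))))) (pow∸1-geom d q)

-- Powers modulo a prime.

%≡%⇒∣∸ : ∀ m n p .{{_ : NonZero p}} → m % p ≡ n % p → p ∣ m ∸ n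
%≡%⇒∣∸ m n p eq = divides (m / p ∸ n / p) (begin-equality
  m ∸ n                                      ≡⟨ cong₂ _∸_ (m≡m%n+[m/n]*n m p) (m≡m%n+[m/n]*n n p) ⟩
  m % p + m / p * p ∸ (n % p + n / p * p)    ≡⟨ cong (λ r → r + m / p * p ∸ (n % p + n / p * p)) eq ⟩
  n % p + m / p * p ∸ (n % p + n / p * p)    ≡⟨ [m+n]∸[m+o]≡n∸o (n % p) _ _ ⟩
  m / p * p ∸ n / p * p                      ≡⟨ *-distribʳ-∸ p (m / p) (n / p) ⟨
  (m / p ∸ n / p) * p                        ∎)
  where open ≤-Reasoning

-- The p powers with exponents 0 to p - 1 have nonzero residues, and `punchOut` at 0 leaves p - 1
-- pigeonholes. Two powers collide, and `u` is the difference of their exponents, not necessarily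
-- the least one possible.
∃-order : ∀ {p} → Prime p → ∀ a → ¬ p ∣ a → ∃[ u ] 1 ≤ u × u < p × p ∣ a ^ u ∸ 1
∃-order {p@(suc p-1)} pp a p∤a = order (Finₚ.pigeonhole (n<1+n p-1) (punchOut ∘ residue≢0))
  where
  residue : Fin p → Fin p
  residue i = fromℕ< (m%n<n (a ^ toℕ i) p)

  residue≢0 : ∀ i → Fin.zero ≢ residue i
  residue≢0 i eq = p∤a (prime∣^⇒∣ pp a (toℕ i) (m%n≡0⇒n∣m _ p
    (trans (sym (Finₚ.toℕ-fromℕ< (m%n<n (a ^ toℕ i) p))) (cong toℕ (sym eq)))))

  order : ∃[ i ] ∃[ j ] (i Fin.< j × punchOut (residue≢0 i) ≡ punchOut (residue≢0 j)) →
          ∃[ u ] 1 ≤ u × u < p × p ∣ a ^ u ∸ 1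
  order (i , j , i<j , eq)
    with euclidsLemma (a ^ toℕ i) (a ^ (toℕ j ∸ toℕ i) ∸ 1) pp p∣product
    where
    aʲ≡ : a ^ toℕ j ≡ a ^ toℕ i * a ^ (toℕ j ∸ toℕ i)
    aʲ≡ = trans (cong (a ^_) (sym (m+[n∸m]≡n (<⇒≤ i<j)))) (^-distribˡ-+-* a (toℕ i) _)
    %≡% : a ^ toℕ j % p ≡ a ^ toℕ i % p
    %≡% = sym (Finₚ.fromℕ<-injective _ _ (m%n<n (a ^ toℕ i) p) (m%n<n (a ^ toℕ j) p)
            (Finₚ.punchOut-injective (residue≢0 i) (residue≢0 j) eq))
    p∣product : p ∣ a ^ toℕ i * (a ^ (toℕ j ∸ toℕ i) ∸ 1)
    p∣product = subst (p ∣_) (trans (cong₂ _∸_ aʲ≡ (sym (*-identityʳ (a ^ toℕ i))))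
      (sym (*-distribˡ-∸ (a ^ toℕ i) (a ^ (toℕ j ∸ toℕ i)) 1))) (%≡%⇒∣∸ (a ^ toℕ j) (a ^ toℕ i) p %≡%)
  ... | inj₁ p∣aⁱ = contradiction (prime∣^⇒∣ pp a (toℕ i) p∣aⁱ) p∤a
  ... | inj₂ p∣   = toℕ j ∸ toℕ i , m<n⇒0<n∸m i<j ,
                    ≤-<-trans (m∸n≤m (toℕ j) (toℕ i)) (Finₚ.toℕ<n j) , p∣

-- Inequalities and rules for powers.

p+2j≤p^1+j : ∀ {p} → 2 ≤ p → ∀ j → p + 2 * j ≤ p ^ (1 + j)
p+2j≤p^1+j {p} 2≤p zero    = ≤-reflexive (trans (+-identityʳ p) (sym (*-identityʳ p)))
p+2j≤p^1+j {p} 2≤p (suc j) = begin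
  p + 2 * suc j        ≡⟨ shift p j ⟩
  (p + 2 * j) + 2      ≤⟨ +-mono-≤ (p+2j≤p^1+j 2≤p j) (≤-trans 2≤p (≤-trans (m≤m+n p (2 * j)) (p+2j≤p^1+j 2≤p j))) ⟩
  y + y                ≡⟨ cong (y +_) (+-identityʳ y) ⟨
  2 * y                ≤⟨ *-monoˡ-≤ y 2≤p ⟩
  p * y                ∎
  where
  open ≤-Reasoning
  y : ℕ
  y = p ^ (1 + j)
  shift : ∀ p j → p + 2 * suc j ≡ (p + 2 * j) + 2
  shift = solve-∀

-- Used with q = p - 1. From q = 5 on, the base 1 + q is at least 6; q = 4 is computed.
6^q≤[1+q]^[1+q] : ∀ q → 4 ≤ q → 6 ^ q ≤ suc q ^ suc q
6^q≤[1+q]^[1+q] (suc (suc (suc (suc zero)))) _ = from-yes (1296 ≤? 3125)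
6^q≤[1+q]^[1+q] q@(suc (suc (suc (suc (suc r))))) _ =
  ≤-trans (^-monoʳ-≤ 6 (n≤1+n q)) (^-monoˡ-≤ (suc q) (m≤m+n 6 r))
6^q≤[1+q]^[1+q] (suc zero) (s≤s ())
6^q≤[1+q]^[1+q] (suc (suc zero)) (s≤s (s≤s ()))
6^q≤[1+q]^[1+q] (suc (suc (suc zero))) (s≤s (s≤s (s≤s ())))

^-cancelʳ-< : ∀ p .{{_ : NonZero p}} {s t} → p ^ s < p ^ t → s < t
^-cancelʳ-< p lt = ≰⇒> (λ t≤s → <⇒≱ lt (^-monoʳ-≤ p t≤s))

^∣^⇒≤ : ∀ p → 1 < p → ∀ {s t} → p ^ s ∣ p ^ t → s ≤ t
^∣^⇒≤ p@(suc _) 1<p {s} {t} p∣ =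
  ≮⇒≥ (λ t<s → <⇒≱ (^-monoʳ-< p 1<p t<s) (∣⇒≤ {{m^n≢0 p t}} p∣))

^-distribʳ-* : ∀ n a b → (a * b) ^ n ≡ a ^ n * b ^ n
^-distribʳ-* zero    a b = refl
^-distribʳ-* (suc n) a b = trans (cong (a * b *_) (^-distribʳ-* n a b)) (swap a b (a ^ n) (b ^ n))
  where
  swap : ∀ a b x y → a * b * (x * y) ≡ a * x * (b * y)
  swap = solve-∀

prime>1 : ∀ {p} → Prime p → 1 < p
prime>1 {p} pp = nonTrivial⇒n>1 p {{prime⇒nonTrivial pp}}

prime∣⇒∤^∸1 : ∀ {p a k} → Prime p → 1 ≤ a → 1 ≤ k → p ∣ a → ¬ p ∣ a ^ k ∸ 1
prime∣⇒∤^∸1 {p} {a@(suc _)} {k@(suc k-1)} pp _ _ p∣a p∣ = <⇒≱ (prime>1 pp) (∣⇒≤ p∣1)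
  where
  p∣1 : p ∣ 1
  p∣1 = ∣m+n∣m⇒∣n (subst (p ∣_) (sym (m∸n+n≡m (m^n>0 a k))) (∣m⇒∣m*n (a ^ k-1) p∣a)) p∣

-- Divide `k` by the head `p` and recurse. Since `p` may occur again in the tail, its powers need
-- the hypothesis with exponent one higher; for other primes, removing `p` changes nothing.
∣-by-prime-powers : ∀ {ps} → All Prime ps → ∀ k →
  (∀ p e → Prime p → p ^ e ∣ product ps → p ^ e ∣ k) → product ps ∣ k
∣-by-prime-powers [] k _ = 1∣ k
∣-by-prime-powers {p ∷ ps} (pp ∷ pps) k h
  with divides k′ refl ← p^1∣⇒p∣ p (h p 1 pp (subst (_∣ p * product ps) (sym (*-identityʳ p)) (m∣m*n _)))
  = subst (p * product ps ∣_) (*-comm p k′) (*-monoʳ-∣ p (∣-by-prime-powers pps k′ h′))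
  where
  h′ : ∀ q e → Prime q → q ^ e ∣ product ps → q ^ e ∣ k′
  h′ q e pq q^e∣ with q ≟ p
  ... | yes refl = *-cancelˡ-∣ q {{prime⇒nonZero pq}}
                     (subst (q ^ suc e ∣_) (*-comm k′ q) (h q (suc e) pq (*-monoʳ-∣ q q^e∣)))
  ... | no q≢p = prime-pow∣* pq 0 e k′ p (h q e pq (∣n⇒∣m*n p q^e∣)) (q∤p ∘ p^1∣⇒p∣ q)
    where
    q∤p : ¬ q ∣ p
    q∤p q∣p with prime⇒irreducible pp q∣p
    ... | inj₁ refl = ¬prime[1] pq
    ... | inj₂ q≡p  = q≢p q≡p

prime[3] : Prime 3
prime[3] = from-yes (prime? 3)

-- Every positive m ≤ n divides k.

module _ {k n : ℕ} (1≤k : 1 ≤ k) (2<n : 2 < n)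
  -- This replaces the equation: a prime dividing xⁿ divides x, so its n-th power divides xⁿ.
  (powerful : ∀ {p} → Prime p → p ∣ (2 ^ k ∸ 1) * (3 ^ k ∸ 1) → p ^ n ∣ (2 ^ k ∸ 1) * (3 ^ k ∸ 1))
  where

  A B : ℕ
  A = 2 ^ k ∸ 1
  B = 3 ^ k ∸ 1

  2^n∣B : 2 ^ n ∣ B
  2^n∣B = prime-pow∣* prime[2] 0 n B A
    (subst (2 ^ n ∣_) (*-comm A B) (powerful prime[2] (∣n⇒∣m*n A 2∣B)))
    (prime∣⇒∤^∸1 prime[2] (s≤s z≤n) 1≤k ∣-refl ∘ p^1∣⇒p∣ 2)
    where
    2∣B : 2 ∣ B
    2∣B = subst (2 ∣_) (sym (pow∸1-geom 2 k)) (m∣m*n (geom 2 k))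

  -- For odd k the cofactor of 3 - 1 in 3ᵏ - 1 is odd, so 2ⁿ would divide 2. Evenness lets the
  -- lifting start from 3² - 1 and 2² - 1.
  2∣k : 2 ∣ k
  2∣k with 2 ∣? k
  ... | yes 2∣k = 2∣k
  ... | no  2∤k = contradiction (^∣^⇒≤ 2 (s≤s (s≤s z≤n)) {n} {1}
        (prime-pow∣* prime[2] 0 n 2 (geom 2 k) (subst (2 ^ n ∣_) (pow∸1-geom 2 k) 2^n∣B)
          (∤⇒∤geom ∣-refl 2∤k ∘ p^1∣⇒p∣ 2)))
        (<⇒≱ (<-trans (s≤s (s≤s z≤n)) 2<n))

  2-power∣k : ∀ e → 2 ^ e ≤ n → 2 ^ e ∣ k
  2-power∣k zero          _ = 1∣ k
  2-power∣k (suc zero)    _ = 2∣k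
  2-power∣k (suc (suc j)) 2^e≤n with 2 ^ suc j ∣? quotient 2∣k
  ... | yes 2^∣ = subst₂ _∣_ (*-comm (2 ^ suc j) 2) (sym (m∣n⇒n≡quotient*m 2∣k)) (*-monoˡ-∣ 2 2^∣)
  -- Lifting from 3² - 1 = 2³ along k / 2 gives n - j ≤ 3, whereas n ≥ 2^(j + 2) ≥ j + 4.
  ... | no  2^∤ = contradiction bound (<⇒≱ 3<n∸j)
    where
    bound : n ∸ j ≤ 3
    bound = ^∣^⇒≤ 2 (s≤s (s≤s z≤n)) {n ∸ j} {3}
      (lifting-pow prime[2] j 3 2 (quotient 2∣k) n (s≤s z≤n) (m∣n⇒n≡quotient*m 2∣k)
        (divides 4 refl) (liftable-two (divides 2 refl)) 2^∤ 2^n∣B)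
    shift : ∀ j → 4 + 2 * j ≡ 2 + 2 * suc j
    shift = solve-∀
    open ≤-Reasoning
    3<n∸j : 3 < n ∸ j
    3<n∸j = m+n≤o⇒m≤o∸n 4 (begin
      4 + j             ≤⟨ +-monoʳ-≤ 4 (m≤n*m j 2) ⟩
      4 + 2 * j         ≡⟨ shift j ⟩
      2 + 2 * suc j     ≤⟨ p+2j≤p^1+j ≤-refl (suc j) ⟩
      2 ^ suc (suc j)   ≤⟨ 2^e≤n ⟩
      n                 ∎)

  3-power∣k : ∀ e → 3 ^ e ≤ n → 3 ^ e ∣ k
  3-power∣k zero    _ = 1∣ k
  3-power∣k (suc j) 3^e≤n with 3 ^ suc j ∣? quotient 2∣k
  ... | yes 3^∣ = ∣-trans 3^∣ (quotient-∣ 2∣k)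
  -- `B` is prime to 3, so 3ⁿ divides `A`. Lifting from 2² - 1 = 3 gives n - j ≤ 1, whereas n ≥ 3^(j
  -- + 1) ≥ j + 2.
  ... | no  3^∤ = contradiction bound (<⇒≱ 1<n∸j)
    where
    3^n∣A : 3 ^ n ∣ A
    3^n∣A = prime-pow∣* prime[3] 0 n A B
      (powerful prime[3] (∣m⇒∣m*n B (∣⇒^∸1∣^∸1 2 (s≤s z≤n) 2∣k)))
      (prime∣⇒∤^∸1 prime[3] (s≤s z≤n) 1≤k ∣-refl ∘ p^1∣⇒p∣ 3)
    bound : n ∸ j ≤ 1
    bound = ^∣^⇒≤ 3 (s≤s (s≤s z≤n)) {n ∸ j} {1}
      (lifting-pow prime[3] j 2 2 (quotient 2∣k) n (s≤s z≤n) (m∣n⇒n≡quotient*m 2∣k)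
        ∣-refl (liftable-odd prime[3] ≤-refl ∣-refl) 3^∤ 3^n∣A)
    open ≤-Reasoning
    1<n∸j : 1 < n ∸ j
    1<n∸j = m+n≤o⇒m≤o∸n 2 (begin
      2 + j         ≤⟨ +-mono-≤ (n≤1+n 2) (m≤n*m j 2) ⟩
      3 + 2 * j     ≤⟨ p+2j≤p^1+j (n≤1+n 2) j ⟩
      3 ^ suc j     ≤⟨ 3^e≤n ⟩
      n             ∎)

  large-prime-power∣k : ∀ {p} → Prime p → 5 ≤ p → (∀ m → 1 ≤ m → m < p → m ∣ k) →
                        ∀ e → p ^ e ≤ n → p ^ e ∣ k
  large-prime-power∣k pp 5≤p small∣k zero _ = 1∣ k
  large-prime-power∣k {p@(suc p-1)} pp 5≤p small∣k (suc j) p^e≤n with p ^ suc j ∣? k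
  ... | yes p^∣ = p^∣
  ... | no  p^∤
    with u , 1≤u , u<p , p∣2ᵘ-1 ← ∃-order pp 2 (>⇒∤ (≤-trans (m≤m+n 3 2) 5≤p))
       | v , 1≤v , v<p , p∣3ᵛ-1 ← ∃-order pp 3 (>⇒∤ (≤-trans (m≤m+n 4 1) 5≤p))
    with divides q k≡q*u ← small∣k u 1≤u u<p | divides r k≡r*v ← small∣k v 1≤v v<p
    -- Both factors may contain p, so its n copies are shared as a + b. Each lifting loses at most j
    -- of them, whence the 2j in the bound.
    with a , b , a+b≡n , p^a∣A , p^b∣B ← prime-pow-split pp n A B
           (powerful pp (∣m⇒∣m*n B (∣-trans p∣2ᵘ-1 (∣⇒^∸1∣^∸1 2 (s≤s z≤n) (divides q k≡q*u)))))
    = contradiction n<p+2j (≤⇒≯ (≤-trans (p+2j≤p^1+j 2≤p j) p^e≤n))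
    where
    open ≤-Reasoning
    2≤p : 2 ≤ p
    2≤p = ≤-trans (m≤m+n 2 3) 5≤p
    2<p : 2 < p
    2<p = ≤-trans (m≤m+n 3 2) 5≤p
    ∤q : ∀ {q w} → k ≡ q * w → ¬ p ^ suc j ∣ q
    ∤q {q} {w} eq p^∣ = p^∤ (subst (p ^ suc j ∣_) (sym eq) (∣m⇒∣m*n w p^∣))
    p^∣2ᵘ-1 : p ^ (a ∸ j) ∣ 2 ^ u ∸ 1
    p^∣2ᵘ-1 = lifting-pow pp j 2 u q a (s≤s z≤n) k≡q*u p∣2ᵘ-1 (liftable-odd pp 2<p p∣2ᵘ-1) (∤q k≡q*u) p^a∣A
    p^∣3ᵛ-1 : p ^ (b ∸ j) ∣ 3 ^ v ∸ 1
    p^∣3ᵛ-1 = lifting-pow pp j 3 v r b (s≤s z≤n) k≡r*v p∣3ᵛ-1 (liftable-odd pp 2<p p∣3ᵛ-1) (∤q k≡r*v) p^b∣B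
    ^∸1>0 : ∀ c w → 1 < c → 1 ≤ w → 1 ≤ c ^ w ∸ 1
    ^∸1>0 c w 1<c 1≤w = m<n⇒0<n∸m (^-monoʳ-< c 1<c 1≤w)
    pᵇ≤3ᵛ-1 : p ^ (b ∸ j) ≤ 3 ^ v ∸ 1
    pᵇ≤3ᵛ-1 = ∣⇒≤ {{>-nonZero (^∸1>0 3 v (s≤s (s≤s z≤n)) 1≤v)}} p^∣3ᵛ-1
    pᵃ≤2ᵘ-1 : p ^ (a ∸ j) ≤ 2 ^ u ∸ 1
    pᵃ≤2ᵘ-1 = ∣⇒≤ {{>-nonZero (^∸1>0 2 u (s≤s (s≤s z≤n)) 1≤u)}} p^∣2ᵘ-1
    ^∸1<^ : ∀ c .{{_ : NonZero c}} {w} → w < p → c ^ w ∸ 1 < c ^ p-1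
    ^∸1<^ c {w} w<p = <-≤-trans (∸-monoʳ-< (s≤s z≤n) (m^n>0 c w)) (^-monoʳ-≤ c (s≤s⁻¹ w<p))
    exponent<p : (a ∸ j) + (b ∸ j) < p
    exponent<p = ^-cancelʳ-< p (begin-strict
      p ^ ((a ∸ j) + (b ∸ j))          ≡⟨ ^-distribˡ-+-* p (a ∸ j) (b ∸ j) ⟩
      p ^ (a ∸ j) * p ^ (b ∸ j)        ≤⟨ *-mono-≤ pᵃ≤2ᵘ-1 pᵇ≤3ᵛ-1 ⟩
      (2 ^ u ∸ 1) * (3 ^ v ∸ 1)        <⟨ *-mono-< (^∸1<^ 2 u<p) (^∸1<^ 3 v<p) ⟩
      2 ^ p-1 * 3 ^ p-1                ≡⟨ ^-distribʳ-* p-1 2 3 ⟨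
      6 ^ p-1                          ≤⟨ 6^q≤[1+q]^[1+q] p-1 (s≤s⁻¹ 5≤p) ⟩
      p ^ p                            ∎)
    regroup : ∀ s t j → (j + s) + (j + t) ≡ (s + t) + 2 * j
    regroup = solve-∀
    n<p+2j : n < p + 2 * j
    -- Truncation is harmless: a ≤ j + (a ∸ j) also when a < j.
    n<p+2j = begin-strict
      n                                ≡⟨ a+b≡n ⟨
      a + b                            ≤⟨ +-mono-≤ (m≤n+m∸n a j) (m≤n+m∸n b j) ⟩
      (j + (a ∸ j)) + (j + (b ∸ j))    ≡⟨ regroup (a ∸ j) (b ∸ j) j ⟩
      (a ∸ j) + (b ∸ j) + 2 * j        <⟨ +-monoˡ-< (2 * j) exponent<p ⟩
      p + 2 * j                        ∎

  prime-power∣k : ∀ {p} → Prime p → (∀ m → 1 ≤ m → m < p → m ∣ k) → ∀ e → p ^ e ≤ n → p ^ e ∣ k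
  prime-power∣k {0} pp _ = contradiction pp ¬prime[0]
  prime-power∣k {1} pp _ = contradiction pp ¬prime[1]
  prime-power∣k {2} _  _ = 2-power∣k
  prime-power∣k {3} _  _ = 3-power∣k
  prime-power∣k {4} pp _ = contradiction pp (composite⇒¬prime composite[4])
  prime-power∣k {suc (suc (suc (suc (suc r))))} pp = large-prime-power∣k pp (m≤m+n 5 r)

  -- A prime p dividing m satisfies p ≤ m, so the exponents u, v < p lie below m and divide k by the
  -- induction hypothesis.
  ≤n⇒∣k : ∀ m → 1 ≤ m → m ≤ n → m ∣ k
  ≤n⇒∣k = <-rec (λ m → 1 ≤ m → m ≤ n → m ∣ k) step
    where
    step : ∀ m → (∀ {m′} → m′ < m → 1 ≤ m′ → m′ ≤ n → m′ ∣ k) → 1 ≤ m → m ≤ n → m ∣ k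
    step m rec 1≤m m≤n = subst (_∣ k) (sym isFactorisation) (∣-by-prime-powers factorsPrime k pow∣k)
      where
      instance
        m≢0 : NonZero m
        m≢0 = >-nonZero 1≤m
      open PrimeFactorisation (factorise m)
      pow∣k : ∀ p e → Prime p → p ^ e ∣ product factors → p ^ e ∣ k
      pow∣k p zero    pp _    = 1∣ k
      pow∣k p (suc e) pp p^∣′ = prime-power∣k pp small∣k (suc e) (≤-trans (∣⇒≤ p^∣) m≤n)
        where
        p^∣ : p ^ suc e ∣ m
        p^∣ = subst (p ^ suc e ∣_) (sym isFactorisation) p^∣′
        small∣k : ∀ m′ → 1 ≤ m′ → m′ < p → m′ ∣ k
        small∣k m′ 1≤m′ m′<p = rec m′<m 1≤m′ (≤-trans (<⇒≤ m′<m) m≤n)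
          where
          m′<m : m′ < m
          m′<m = <-≤-trans m′<p (∣⇒≤ (m*n∣⇒m∣ p (p ^ e) p^∣))

-- The product lies strictly between consecutive n-th powers.

-- Raising the exponent by one multiplies the right side by 1 + c and each term on the left by at
-- most that.
power-gap : ∀ c a b → a ≤ 1 + c → b ≤ 1 + c → c ^ 3 + (a ^ 3 + b ^ 3) ≤ (1 + c) ^ 3 →
            ∀ i → c ^ (3 + i) + (a ^ (3 + i) + b ^ (3 + i)) ≤ (1 + c) ^ (3 + i)
power-gap c a b a≤s b≤s base zero    = base
power-gap c a b a≤s b≤s base (suc i) = begin
  c * x + (a * y + b * z)            ≤⟨ +-mono-≤ (*-monoˡ-≤ x (n≤1+n c))
                                          (+-mono-≤ (*-monoˡ-≤ y a≤s) (*-monoˡ-≤ z b≤s)) ⟩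
  s * x + (s * y + s * z)            ≡⟨ distrib s x y z ⟩
  s * (x + (y + z))                  ≤⟨ *-monoʳ-≤ s (power-gap c a b a≤s b≤s base i) ⟩
  s * s ^ (3 + i)                    ∎
  where
  open ≤-Reasoning
  s x y z : ℕ
  s = 1 + c
  x = c ^ (3 + i)
  y = a ^ (3 + i)
  z = b ^ (3 + i)
  distrib : ∀ s x y z → s * x + (s * y + s * z) ≡ s * (x + (y + z))
  distrib = solve-∀

-- Both 8 and 27 are at most 36, so the two small cubes are each at most 36^m = (1 + c)².
cube-gap : ∀ m c → 1 ≤ m → 1 + c ≡ 6 ^ m → c ^ 3 + ((2 ^ m) ^ 3 + (3 ^ m) ^ 3) ≤ (1 + c) ^ 3
cube-gap m c 1≤m 1+c≡6ᵐ = begin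
  c ^ 3 + ((2 ^ m) ^ 3 + (3 ^ m) ^ 3)        ≤⟨ +-monoʳ-≤ (c ^ 3) (+-mono-≤ (cube≤ 2 (m≤m+n 8 28)) (cube≤ 3 (m≤m+n 27 9))) ⟩
  c ^ 3 + ((1 + c) ^ 2 + (1 + c) ^ 2)        ≤⟨ cubic c 2≤c ⟩
  (1 + c) ^ 3                                ∎
  where
  open ≤-Reasoning
  2≤c : 2 ≤ c
  2≤c = s≤s⁻¹ (≤-trans (≤-trans (m≤m+n 3 3) (^-monoʳ-≤ 6 1≤m)) (≤-reflexive (sym 1+c≡6ᵐ)))
  cubic : ∀ c → 2 ≤ c → c ^ 3 + ((1 + c) ^ 2 + (1 + c) ^ 2) ≤ (1 + c) ^ 3
  cubic c 2≤c with t , refl ← m≤n⇒∃[o]m+o≡n 2≤c =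
    -- The slack is c² - c - 1 at c = 2 + t.
    ≤-trans (m≤m+n _ (t * t + 3 * t + 1)) (≤-reflexive (identity t))
    where
    identity : ∀ t → (2 + t) * ((2 + t) * ((2 + t) * 1)) + ((3 + t) * ((3 + t) * 1) + (3 + t) * ((3 + t) * 1))
             + (t * t + 3 * t + 1) ≡ (3 + t) * ((3 + t) * ((3 + t) * 1))
    identity = solve-∀
  swap-exponents : ∀ d e → (d ^ m) ^ e ≡ (d ^ e) ^ m
  swap-exponents d e = trans (^-*-assoc d m e) (trans (cong (d ^_) (*-comm m e)) (sym (^-*-assoc d e m)))
  cube≤ : ∀ d → d ^ 3 ≤ 36 → (d ^ m) ^ 3 ≤ (1 + c) ^ 2
  cube≤ d d³≤36 = begin
    (d ^ m) ^ 3   ≡⟨ swap-exponents d 3 ⟩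
    (d ^ 3) ^ m   ≤⟨ ^-monoˡ-≤ m d³≤36 ⟩
    36 ^ m        ≡⟨ swap-exponents 6 2 ⟨
    (6 ^ m) ^ 2   ≡⟨ cong (_^ 2) 1+c≡6ᵐ ⟨
    (1 + c) ^ 2   ∎

product-not-power : ∀ n m → 2 < n → 1 ≤ m → ∀ x →
                 ¬ ((2 ^ m) ^ n ∸ 1) * ((3 ^ m) ^ n ∸ 1) ≡ x ^ n
product-not-power n m 2<n 1≤m x eq with i , refl ← m≤n⇒∃[o]m+o≡n 2<n = <⇒≱ cⁿ<xⁿ (^-monoˡ-≤ n x≤c)
  where
  open ≤-Reasoning
  c α β : ℕ
  c = 6 ^ m ∸ 1
  α = (2 ^ m) ^ n ∸ 1
  β = (3 ^ m) ^ n ∸ 1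
  1+c≡ : 1 + c ≡ 6 ^ m
  1+c≡ = m+[n∸m]≡n (m^n>0 6 m)
  1+α≡ : 1 + α ≡ (2 ^ m) ^ n
  1+α≡ = m+[n∸m]≡n (m^n>0 (2 ^ m) {{m^n≢0 2 m}} n)
  1+β≡ : 1 + β ≡ (3 ^ m) ^ n
  1+β≡ = m+[n∸m]≡n (m^n>0 (3 ^ m) {{m^n≢0 3 m}} n)
  product≡ : (1 + α) * (1 + β) ≡ (1 + c) ^ n
  product≡ = begin-equality
    (1 + α) * (1 + β)             ≡⟨ cong₂ _*_ 1+α≡ 1+β≡ ⟩
    (2 ^ m) ^ n * (3 ^ m) ^ n     ≡⟨ ^-distribʳ-* n (2 ^ m) (3 ^ m) ⟨
    (2 ^ m * 3 ^ m) ^ n           ≡⟨ cong (_^ n) (^-distribʳ-* m 2 3) ⟨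
    (6 ^ m) ^ n                   ≡⟨ cong (_^ n) 1+c≡ ⟨
    (1 + c) ^ n                   ∎
  base≤ : ∀ d → d ≤ 6 → d ^ m ≤ 1 + c
  base≤ d d≤6 = ≤-trans (^-monoˡ-≤ m d≤6) (≤-reflexive (sym 1+c≡))
  expand : ∀ α β → (1 + α) * (1 + β) ≡ α * β + (1 + (α + β))
  expand = solve-∀
  regroup : ∀ x α β → suc x + (1 + (α + β)) ≡ x + ((1 + α) + (1 + β))
  regroup = solve-∀
  -- With k = m n, xⁿ = 6ᵏ - 2ᵏ - 3ᵏ + 1, and `power-gap` gives cⁿ + 2ᵏ + 3ᵏ ≤ 6ᵏ. Adding 1 + α + β
  -- to both sides avoids subtraction.
  cⁿ<xⁿ : c ^ n < x ^ n
  cⁿ<xⁿ = +-cancelʳ-≤ (1 + (α + β)) _ _ (begin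
    suc (c ^ n) + (1 + (α + β))                   ≡⟨ regroup (c ^ n) α β ⟩
    c ^ n + ((1 + α) + (1 + β))                   ≡⟨ cong (c ^ n +_) (cong₂ _+_ 1+α≡ 1+β≡) ⟩
    c ^ n + ((2 ^ m) ^ n + (3 ^ m) ^ n)           ≤⟨ power-gap c (2 ^ m) (3 ^ m) (base≤ 2 (m≤m+n 2 4)) (base≤ 3 (m≤m+n 3 3))
                                                       (cube-gap m c 1≤m 1+c≡) i ⟩
    (1 + c) ^ n                                   ≡⟨ product≡ ⟨
    (1 + α) * (1 + β)                             ≡⟨ expand α β ⟩
    α * β + (1 + (α + β))                         ≡⟨ cong (_+ (1 + (α + β))) eq ⟩
    x ^ n + (1 + (α + β))                         ∎)
  xⁿ<[1+c]ⁿ : x ^ n < (1 + c) ^ n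
  xⁿ<[1+c]ⁿ = begin-strict
    x ^ n                    ≡⟨ eq ⟨
    α * β                    <⟨ *-mono-< (n<1+n α) (n<1+n β) ⟩
    (1 + α) * (1 + β)        ≡⟨ product≡ ⟩
    (1 + c) ^ n              ∎
  x≤c : x ≤ c
  x≤c = s≤s⁻¹ (≰⇒> (λ 1+c≤x → <⇒≱ xⁿ<[1+c]ⁿ (^-monoˡ-≤ n 1+c≤x)))

theorem1 : (k x n : ℕ) → 1 ≤ k → 1 ≤ x → 2 < n →
    ¬ ((2 ^ k ∸ 1) * (3 ^ k ∸ 1) ≡ x ^ n)
theorem1 k x n 1≤k 1≤x 2<n eq
  with ≤n⇒∣k 1≤k 2<n powerful n (≤-trans (s≤s z≤n) 2<n) ≤-refl
  where
  powerful : ∀ {p} → Prime p → p ∣ (2 ^ k ∸ 1) * (3 ^ k ∸ 1) → p ^ n ∣ (2 ^ k ∸ 1) * (3 ^ k ∸ 1)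
  powerful {p} pp p∣ = subst (p ^ n ∣_) (sym eq)
    (^-monoˡ-∣ n (prime∣^⇒∣ pp x n (subst (p ∣_) eq p∣)))
... | divides zero    refl = contradiction 1≤k (λ ())
... | divides (suc m) refl = product-not-power n (suc m) 2<n (s≤s z≤n) x
  (trans (cong₂ (λ y z → (y ∸ 1) * (z ∸ 1)) (^-*-assoc 2 (suc m) n) (^-*-assoc 3 (suc m) n)) eq)
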